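{- Let $m$ be a non-negative integer, let $c_0,c_1,\dots,c_m\in\mathbb{C}$, let $a,x$ be non-zero complex numbers, and let $\lambda\in\mathbb{C}$ satisfy $\lambda\neq 0$ and $(\lambda;\lambda)_m\neq 0$. Then $$c_0+\frac{c_1}{x}+\cdots+\frac{c_m}{x^m}=\sum_{k=0}^{m}\left(\sum_{i=k}^{m}\frac{c_i}{a^i}\genfrac{[}{]}{0pt}{}{i}{k}_{\lambda}\right)(-1)^k\lambda^{\binom{k}{2}}(x-a)_\lambda^k.$$
   Context: $(x-a)_\lambda^0=1$ and $(x-a)_\lambda^k=\prod_{j=0}^{k-1}\left(1-\frac{a}{\lambda^j x}\right)$ for $k\ge 1$ (not an ordinary power). $(q;q)_0=1$, $(q;q)_m=\prod_{j=1}^m(1-q^j)$, and the $q$-binomial coefficient is $\genfrac{[}{]}{0pt}{}{i}{k}_{q}=\frac{(q;q)_i}{(q;q)_k(q;q)_{i-k}}$. -}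

module Defs where

open import Algebra.Apartness.Bundles using (HeytingField; HeytingCommutativeRing)
open import Algebra.Bundles using (CommutativeRing; Semiring)
open import Data.Fin.Base using (Fin; zero; suc; toℕ; inject≤)
open import Data.Fin.Properties using (toℕ≤pred[n]; toℕ-inject≤)
open import Data.Nat.Base as ℕ using (ℕ; _∸_; _≤_)
open import Data.Nat.Properties using (≤-trans; m∸n≤m)
open import Data.Product.Base using (_,_; proj₁; proj₂)
open import Data.Vec.Functional using (Vector; head; tail)
open import Function.Base using (_∘_)
open import Relation.Binary.PropositionalEquality.Core using (subst)

-- In a Heyting field, x # 0# holds exactly when x is invertible; classically,
-- with x # y taken to be ¬ (x ≈ y), Heyting fields are just fields.
module QCalculus {c ℓ₁ ℓ₂} (F : HeytingField c ℓ₁ ℓ₂) where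

  open HeytingField F hiding (zero)
  open HeytingCommutativeRing heytingCommutativeRing using (commutativeRing)
  open CommutativeRing commutativeRing using (semiring; +-monoid)
  open Semiring semiring using (rawSemiring)
  open import Algebra.Apartness.Properties.HeytingCommutativeRing heytingCommutativeRing
  open import Algebra.Definitions.RawSemiring rawSemiring public using (_^_; sum; product)
  open import Algebra.Properties.Monoid.Sum +-monoid public using (sum⁺-syntax)

  -- Sum of f i over the indices i with k ≤ i.
  sumFrom : ∀ {n} → Fin n → Vector Carrier n → Carrier
  sumFrom zero    f = sum f
  sumFrom (suc k) f = sumFrom k (tail f)

  infixl 10 sumFrom
  syntax sumFrom k (λ i → e) = ∑[ i ≥ k ] e

  -- #⇒invertible y#0 inverts y - 0# rather than y; see /-inverse.
  infixl 7 _/_[_]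
  _/_[_] : (x y : Carrier) → y # 0# → Carrier
  x / y [ y#0 ] = x * proj₁ (#⇒invertible y#0)

  /-inverse : ∀ {y} (y#0 : y # 0#) → y / y [ y#0 ] ≈ 1#
  /-inverse {y} y#0 = trans (*-congʳ (sym (x-0≈x y))) (proj₂ (proj₂ (#⇒invertible y#0)))

  ^#0 : ∀ {x} → x # 0# → ∀ n → x ^ n # 0#
  ^#0 x#0 ℕ.zero    = 1#0
  ^#0 x#0 (ℕ.suc n) = x#0y#0→xy#0 x#0 (^#0 x#0 n)

  -- (x - a)_q^k
  qPower : (x a q : Carrier) → x # 0# → q # 0# → ℕ → Carrier
  qPower x a q x#0 q#0 k =
    product {k} λ j → 1# - a / (q ^ toℕ j * x) [ x#0y#0→xy#0 (^#0 q#0 (toℕ j)) x#0 ]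

  -- (q ; q)_m
  qPochhammer : Carrier → ℕ → Carrier
  qPochhammer q m = product {m} λ j → 1# - q ^ ℕ.suc (toℕ j)

  -- Intended for k ≤ i only: truncated subtraction makes it meaningless otherwise.
  qBinomial : (q : Carrier) (i k : ℕ) →
              qPochhammer q k * qPochhammer q (i ∸ k) # 0# → Carrier
  qBinomial q i k den#0 =
    qPochhammer q i / (qPochhammer q k * qPochhammer q (i ∸ k)) [ den#0 ]

  xy#0→y#0 : ∀ {x y} → x * y # 0# → y # 0#
  xy#0→y#0 {x} {y} xy#0 with z , z*[xy-0]≈1 , _ ← #⇒invertible xy#0 =
    invertibleˡ⇒# (z * x , trans (*-congˡ (x-0≈x y))
      (trans (*-assoc z x y) (trans (*-congˡ (sym (x-0≈x (x * y)))) z*[xy-0]≈1)))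

  xy#0→x#0 : ∀ {x y} → x * y # 0# → x # 0#
  xy#0→x#0 {x} {y} xy#0 = xy#0→y#0 (#-congʳ (*-comm x y) xy#0)

  product#0→factor#0 : ∀ {n} (f : Vector Carrier n) → product f # 0# → ∀ i → f i # 0#
  product#0→factor#0 f p zero    = xy#0→x#0 p
  product#0→factor#0 f p (suc i) = product#0→factor#0 (tail f) (xy#0→y#0 {head f} p) i

  factor#0→product#0 : ∀ {n} (f : Vector Carrier n) → (∀ i → f i # 0#) → product f # 0#
  factor#0→product#0 {ℕ.zero}  f p = 1#0
  factor#0→product#0 {ℕ.suc n} f p = x#0y#0→xy#0 (p zero) (factor#0→product#0 (tail f) (p ∘ suc))

  qPochhammer#0 : ∀ {q k m} → k ≤ m → qPochhammer q m # 0# → qPochhammer q k # 0#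
  qPochhammer#0 {q} {k} k≤m p = factor#0→product#0 {k} _ λ j →
    subst (λ n → 1# - q ^ ℕ.suc n # 0#) (toℕ-inject≤ j k≤m)
      (product#0→factor#0 _ p (inject≤ j k≤m))

  qBinomialDenominator#0 : ∀ {q m} → qPochhammer q m # 0# → (i k : Fin (ℕ.suc m)) →
                           qPochhammer q (toℕ k) * qPochhammer q (toℕ i ∸ toℕ k) # 0#
  qBinomialDenominator#0 {q} p i k = x#0y#0→xy#0
    (qPochhammer#0 {q} (toℕ≤pred[n] k) p)
    (qPochhammer#0 {q} (≤-trans (m∸n≤m (toℕ i) (toℕ k)) (toℕ≤pred[n] i)) p)

{-# OPTIONS --safe #-}

-- Put t = a/x. Since (t - q^j) = - q^j (1 - a/(q^j x)), the product
-- (-1)^k q^(k choose 2) (x - a)_q^k equals R_k = ∏_{j<k} (t - q^j). From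
-- t R_k = R_{k+1} + q^k R_k and the q-Pascal rule one gets Cauchy's expansion
-- t^i = ∑_k [i choose k]_q R_k; multiply by c_i/a^i and exchange the two sums.

module Submission where

open import Defs
open import Level using (Level)
open import Algebra.Apartness.Bundles using (HeytingField; HeytingCommutativeRing)
open import Algebra.Bundles using (CommutativeRing)
open import Data.Fin.Base using (Fin; zero; suc; toℕ)
open import Data.Fin.Properties using (toℕ-inject₁; toℕ-fromℕ; toℕ<n)
open import Data.Nat.Base as ℕ using (ℕ; suc; _∸_; _≤_; _<_; z≤n; s≤s)
open import Data.Nat.Combinatorics using (_C_; nC1≡n; nCk+nC[k+1]≡[n+1]C[k+1])
open import Data.Nat.Properties as ℕ using (m+[n∸m]≡n)
open import Data.Vec.Functional using (Vector)
open import Function.Base using (_∘_)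
open import Relation.Binary.PropositionalEquality.Core as ≡ using (_≡_)

module _ {ℓ ℓ₁ ℓ₂} (F : HeytingField ℓ ℓ₁ ℓ₂) where

  open HeytingField F hiding (zero)
  open HeytingCommutativeRing heytingCommutativeRing using (commutativeRing)
  open CommutativeRing commutativeRing
    using (ring; semiring; commutativeSemiring; +-group; *-monoid; *-commutativeSemigroup)
  open QCalculus F
  open import Algebra.Apartness.Properties.HeytingCommutativeRing heytingCommutativeRing
    using (x#0y#0→xy#0)
  open import Algebra.Properties.Ring ring using (-1*x≈-x; x[y-z]≈xy-xz)
  open import Algebra.Properties.Group +-group using (//-rightDividesˡ; ⁻¹-anti-homo-//)
  open import Algebra.Properties.CommutativeSemigroup *-commutativeSemigroup
    using (interchange; x∙yz≈y∙xz; xy∙z≈y∙xz; xy∙z≈xz∙y)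
  open import Algebra.Properties.Semiring.Sum semiring
    using (sum-syntax; sum-cong-≋; sum-replicate-zero; sum-init-last; ∑-distrib-+; ∑-comm;
           *-distribˡ-sum; *-distribʳ-sum)
  open import Algebra.Properties.Semiring.Exp semiring using (^-homo-*; ^-congˡ)
  open import Algebra.Properties.CommutativeSemiring.Exp commutativeSemiring using (^-distrib-*)
  open import Algebra.Properties.Monoid.Sum *-monoid
    using () renaming (sum-init-last to product-init-last; sum-cong-≋ to product-cong-≋)
  open import Relation.Binary.Reasoning.Setoid setoid

  -- Finite sums and products.

  sum-zero : ∀ {n} {f : Vector Carrier n} → (∀ i → f i ≈ 0#) → sum f ≈ 0#
  sum-zero {n} f≈0 = trans (sum-cong-≋ f≈0) (sum-replicate-zero n)

  sum-snoc : (f : ℕ → Carrier) (n : ℕ) →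
             sum {suc n} (f ∘ toℕ) ≈ sum {n} (f ∘ toℕ) + f n
  sum-snoc f n = trans (sum-init-last {n} (f ∘ toℕ))
    (+-cong (sum-cong-≋ {n} (λ j → reflexive (≡.cong f (toℕ-inject₁ j))))
            (reflexive (≡.cong f (toℕ-fromℕ n))))

  -- `product` unfolds at its first factor, whereas `qPochhammer` and `qPower` gain a factor at the
  -- last index when their length grows by one.
  product-snoc : (f : ℕ → Carrier) (n : ℕ) →
                 product {suc n} (f ∘ toℕ) ≈ product {n} (f ∘ toℕ) * f n
  product-snoc f n = trans (product-init-last {n} (f ∘ toℕ))
    (*-cong (product-cong-≋ {n} (λ j → reflexive (≡.cong f (toℕ-inject₁ j))))
            (reflexive (≡.cong f (toℕ-fromℕ n))))

  -- Turns a sum over the whole range into one starting at `k`. The values of `g` below `k` never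
  -- enter, so `g` may be built from `qBinomial`, which is meaningful only for `k ≤ i`.
  sum≈sumFrom : ∀ {n} (k : Fin n) {f g : Vector Carrier n} →
                (∀ i → toℕ i < toℕ k → f i ≈ 0#) →
                (∀ i → toℕ k ≤ toℕ i → f i ≈ g i) →
                sum f ≈ sumFrom k g
  sum≈sumFrom zero    below above = sum-cong-≋ (λ i → above i z≤n)
  sum≈sumFrom (suc k) below above =
    trans (+-congʳ (below zero (s≤s z≤n)))
      (trans (+-identityˡ _)
        (sum≈sumFrom k (λ i → below (suc i) ∘ s≤s) (λ i → above (suc i) ∘ s≤s)))

  -- Division and the rescaling to powers of `a / x`.

  /-*-cancel : ∀ x {y} (y#0 : y # 0#) → x / y [ y#0 ] * y ≈ x
  /-*-cancel x {y} y#0 = begin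
    x / y [ y#0 ] * y     ≈⟨ xy∙z≈xz∙y x _ y ⟩
    x * y * _             ≈⟨ *-assoc x y _ ⟩
    x * (y / y [ y#0 ])   ≈⟨ *-congˡ (/-inverse y#0) ⟩
    x * 1#                ≈⟨ *-identityʳ x ⟩
    x                     ∎

  /-unique : ∀ {x y z} (y#0 : y # 0#) → z * y ≈ x → x / y [ y#0 ] ≈ z
  /-unique {x} {y} {z} y#0 zy≈x = begin
    x / y [ y#0 ]         ≈⟨ *-congʳ zy≈x ⟨
    z * y * _             ≈⟨ *-assoc z y _ ⟩
    z * (y / y [ y#0 ])   ≈⟨ *-congˡ (/-inverse y#0) ⟩
    z * 1#                ≈⟨ *-identityʳ z ⟩
    z                     ∎

  -- With `t = a / x` one has `t * x ≈ a`, hence `t ^ n * x ^ n ≈ a ^ n`, and uniqueness of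
  -- quotients gives the claim.
  /-^-rescale : ∀ c {a x} (a#0 : a # 0#) (x#0 : x # 0#) n →
                c / x ^ n [ ^#0 x#0 n ] ≈ c / a ^ n [ ^#0 a#0 n ] * (a / x [ x#0 ]) ^ n
  /-^-rescale c {a} {x} a#0 x#0 n = /-unique (^#0 x#0 n) (begin
    c / a ^ n [ ^#0 a#0 n ] * t ^ n * x ^ n     ≈⟨ *-assoc _ _ _ ⟩
    c / a ^ n [ ^#0 a#0 n ] * (t ^ n * x ^ n)   ≈⟨ *-congˡ (^-distrib-* t x n) ⟨
    c / a ^ n [ ^#0 a#0 n ] * (t * x) ^ n       ≈⟨ *-congˡ (^-congˡ n (/-*-cancel a x#0)) ⟩
    c / a ^ n [ ^#0 a#0 n ] * a ^ n             ≈⟨ /-*-cancel c (^#0 a#0 n) ⟩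
    c                                           ∎)
    where t = a / x [ x#0 ]

  [1-u]+u[1-v]≈1-uv : ∀ u v → (1# - u) + u * (1# - v) ≈ 1# - u * v
  [1-u]+u[1-v]≈1-uv u v = begin
    (1# - u) + u * (1# - v)        ≈⟨ +-congˡ (x[y-z]≈xy-xz u 1# v) ⟩
    (1# - u) + (u * 1# - u * v)    ≈⟨ +-congˡ (+-congʳ (*-identityʳ u)) ⟩
    (1# - u) + (u - u * v)         ≈⟨ +-assoc _ u _ ⟨
    (1# - u) + u - u * v           ≈⟨ +-congʳ (//-rightDividesˡ u 1#) ⟩
    1# - u * v                     ∎

  -- Gaussian binomial coefficients.

  qPochhammer-suc : ∀ q n → qPochhammer q (suc n) ≈ qPochhammer q n * (1# - q ^ suc n)
  qPochhammer-suc q = product-snoc (λ j → 1# - q ^ suc j)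

  -- The q-binomial coefficient defined by the q-Pascal rule: it needs no
  -- division and vanishes for k > i.
  gauss : Carrier → ℕ → ℕ → Carrier
  gauss q i       ℕ.zero  = 1#
  gauss q ℕ.zero  (suc k) = 0#
  gauss q (suc i) (suc k) = gauss q i k + q ^ suc k * gauss q i (suc k)

  gauss-> : ∀ q {i k} → i < k → gauss q i k ≈ 0#
  gauss-> q {ℕ.zero} (s≤s _)   = refl
  gauss-> q {suc i}  {suc k} (s≤s i<k) = begin
    gauss q i k + q ^ suc k * gauss q i (suc k)
      ≈⟨ +-cong (gauss-> q i<k) (*-congˡ (gauss-> q (ℕ.m<n⇒m<1+n i<k))) ⟩
    0# + q ^ suc k * 0#   ≈⟨ +-identityˡ _ ⟩
    q ^ suc k * 0#        ≈⟨ zeroʳ _ ⟩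
    0#                    ∎

  gauss-diag : ∀ q k → gauss q k k ≈ 1#
  gauss-diag q ℕ.zero  = refl
  gauss-diag q (suc k) = begin
    gauss q k k + q ^ suc k * gauss q k (suc k)
      ≈⟨ +-cong (gauss-diag q k) (*-congˡ (gauss-> q (ℕ.n<1+n k))) ⟩
    1# + q ^ suc k * 0#   ≈⟨ +-congˡ (zeroʳ _) ⟩
    1# + 0#               ≈⟨ +-identityʳ 1# ⟩
    1#                    ∎

  -- The factorial formula cleared of denominators, with the upper index written as `k + j` to avoid
  -- truncated subtraction. It follows from the q-Pascal rule by induction: one term lowers `k`, the
  -- other lowers `j`.
  gauss-factorial : ∀ q k j →
    gauss q (k ℕ.+ j) k * (qPochhammer q k * qPochhammer q j) ≈ qPochhammer q (k ℕ.+ j)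
  gauss-factorial q ℕ.zero  j = trans (*-identityˡ _) (*-identityˡ _)
  -- On the diagonal the second q-Pascal term vanishes, so there is no smaller `j` to recurse on and
  -- `gauss-diag` takes over.
  gauss-factorial q (suc k) ℕ.zero
    rewrite ℕ.+-identityʳ k = begin
    gauss q (suc k) (suc k) * (qPochhammer q (suc k) * 1#)
      ≈⟨ *-cong (gauss-diag q (suc k)) (*-identityʳ _) ⟩
    1# * qPochhammer q (suc k)   ≈⟨ *-identityˡ _ ⟩
    qPochhammer q (suc k)        ∎
  gauss-factorial q (suc k) (suc j) = begin
    (G₁ + u * G₂) * (qPochhammer q (suc k) * qPochhammer q (suc j))
      ≈⟨ distribʳ _ G₁ _ ⟩
    G₁ * (qPochhammer q (suc k) * qPochhammer q (suc j)) +
      u * G₂ * (qPochhammer q (suc k) * qPochhammer q (suc j))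
      -- Each term becomes a multiple of the same `N`; the coefficients add up to `1# - u * v`,
      -- which is the last factor of the larger Pochhammer product because `u * v` is
      -- `q ^ (suc k + suc j)`.
      ≈⟨ +-cong left right ⟩
    (1# - u) * N + u * (1# - v) * N
      ≈⟨ distribʳ N _ _ ⟨
    ((1# - u) + u * (1# - v)) * N
      ≈⟨ *-congʳ ([1-u]+u[1-v]≈1-uv u v) ⟩
    (1# - u * v) * N
      ≈⟨ *-congʳ (+-congˡ (-‿cong (^-homo-* q (suc k) (suc j)))) ⟨
    (1# - q ^ (suc k ℕ.+ suc j)) * N
      ≈⟨ *-comm _ N ⟩
    N * (1# - q ^ (suc k ℕ.+ suc j))
      ≈⟨ qPochhammer-suc q (k ℕ.+ suc j) ⟨
    qPochhammer q (suc k ℕ.+ suc j) ∎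
    where
    u = q ^ suc k
    v = q ^ suc j
    N = qPochhammer q (k ℕ.+ suc j)
    G₁ = gauss q (k ℕ.+ suc j) k
    G₂ = gauss q (k ℕ.+ suc j) (suc k)

    left : G₁ * (qPochhammer q (suc k) * qPochhammer q (suc j)) ≈ (1# - u) * N
    left = begin
      G₁ * (qPochhammer q (suc k) * qPochhammer q (suc j))
        ≈⟨ *-congˡ (*-congʳ (qPochhammer-suc q k)) ⟩
      G₁ * (qPochhammer q k * (1# - u) * qPochhammer q (suc j))
        ≈⟨ *-congˡ (xy∙z≈y∙xz _ _ _) ⟩
      G₁ * ((1# - u) * (qPochhammer q k * qPochhammer q (suc j)))
        ≈⟨ x∙yz≈y∙xz _ _ _ ⟩
      (1# - u) * (G₁ * (qPochhammer q k * qPochhammer q (suc j)))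
        ≈⟨ *-congˡ (gauss-factorial q k (suc j)) ⟩
      (1# - u) * N ∎

    G₂-factorial : G₂ * (qPochhammer q (suc k) * qPochhammer q j) ≈ N
    -- Reading `k + suc j` as `suc k + j` makes the induction hypothesis at `suc k` and `j`
    -- applicable.
    G₂-factorial rewrite ℕ.+-suc k j = gauss-factorial q (suc k) j

    right : u * G₂ * (qPochhammer q (suc k) * qPochhammer q (suc j)) ≈ u * (1# - v) * N
    right = begin
      u * G₂ * (qPochhammer q (suc k) * qPochhammer q (suc j))
        ≈⟨ *-congˡ (*-congˡ (qPochhammer-suc q j)) ⟩
      u * G₂ * (qPochhammer q (suc k) * (qPochhammer q j * (1# - v)))
        ≈⟨ *-congˡ (trans (sym (*-assoc _ _ _)) (*-comm _ _)) ⟩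
      u * G₂ * ((1# - v) * (qPochhammer q (suc k) * qPochhammer q j))
        ≈⟨ interchange u G₂ (1# - v) _ ⟩
      u * (1# - v) * (G₂ * (qPochhammer q (suc k) * qPochhammer q j))
        ≈⟨ *-congˡ G₂-factorial ⟩
      u * (1# - v) * N ∎

  qBinomial≈gauss : ∀ q {i k} → k ≤ i →
    (den#0 : qPochhammer q k * qPochhammer q (i ∸ k) # 0#) →
    qBinomial q i k den#0 ≈ gauss q i k
  qBinomial≈gauss q {i} {k} k≤i den#0 = /-unique den#0
    (≡.subst (λ n → gauss q n k * (qPochhammer q k * qPochhammer q (i ∸ k)) ≈ qPochhammer q n)
      (m+[n∸m]≡n k≤i) (gauss-factorial q k (i ∸ k)))

  -- Cauchy's expansion of a power.

  shiftedPower : (t q : Carrier) → ℕ → Carrier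
  shiftedPower t q ℕ.zero  = 1#
  shiftedPower t q (suc k) = (t - q ^ k) * shiftedPower t q k

  -- Split `t` as `(t - q ^ k) + q ^ k`; the first part supplies the next factor of the product.
  *-shiftedPower : ∀ t q k →
    t * shiftedPower t q k ≈ shiftedPower t q (suc k) + q ^ k * shiftedPower t q k
  *-shiftedPower t q k =
    trans (*-congʳ (sym (//-rightDividesˡ (q ^ k) t))) (distribʳ _ _ _)

  -- Any `n` above `i` is allowed, since `gauss` vanishes for `k > i`. All powers up to `m` thus
  -- share one summation range, as the later exchange of sums requires.
  cauchyExpansion : ∀ t q {i n} → i < n →
    t ^ i ≈ ∑[ k < n ] (gauss q i (toℕ k) * shiftedPower t q (toℕ k))
  cauchyExpansion t q {ℕ.zero} {suc n} _ = sym (begin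
    1# * 1# + _   ≈⟨ +-cong (*-identityˡ 1#) (sum-zero {n} (λ k → zeroˡ _)) ⟩
    1# + 0#       ≈⟨ +-identityʳ 1# ⟩
    1#            ∎)
  cauchyExpansion t q {suc i} {suc n} (s≤s i<n) = begin
    t * t ^ i
      ≈⟨ *-congˡ (cauchyExpansion t q i<n) ⟩
    t * ∑[ k < n ] (g (toℕ k) * r (toℕ k))
      ≈⟨ *-distribˡ-sum {n} t _ ⟩
    ∑[ k < n ] (t * (g (toℕ k) * r (toℕ k)))
      ≈⟨ sum-cong-≋ {n} (λ k → step (toℕ k)) ⟩
    ∑[ k < n ] (g (toℕ k) * r (suc (toℕ k)) + h (toℕ k))
      ≈⟨ ∑-distrib-+ {n} _ _ ⟩
    A + ∑[ k < n ] h (toℕ k)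
      -- The sum of `h` is shifted by one index to line up with `A`, whose shifted powers already
      -- have index `suc k`. The added top term `h n` is zero because `i < n`.
      ≈⟨ +-congˡ extend ⟩
    A + (h 0 + B)
      ≈⟨ trans (sym (+-assoc _ _ _)) (trans (+-congʳ (+-comm _ _)) (+-assoc _ _ _)) ⟩
    h 0 + (A + B)
      ≈⟨ +-cong (*-congʳ (*-identityˡ 1#)) (sym (∑-distrib-+ {n} _ _)) ⟩
    1# * 1# + ∑[ k < n ] (g (toℕ k) * r (suc (toℕ k)) + h (suc (toℕ k)))
      -- The two coefficients of `r (suc k)` combine to `gauss q (suc i) (suc k)`, by the defining
      -- q-Pascal rule.
      ≈⟨ +-congˡ (sum-cong-≋ {n} (λ k → sym (distribʳ _ _ _))) ⟩
    ∑[ k < suc n ] (gauss q (suc i) (toℕ k) * r (toℕ k)) ∎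
    where
    g = gauss q i
    r = shiftedPower t q

    h : ℕ → Carrier
    h k = q ^ k * g k * r k

    A = ∑[ k < n ] (g (toℕ k) * r (suc (toℕ k)))
    B = ∑[ k < n ] h (suc (toℕ k))

    step : ∀ k → t * (g k * r k) ≈ g k * r (suc k) + h k
    step k = begin
      t * (g k * r k)                           ≈⟨ x∙yz≈y∙xz t _ _ ⟩
      g k * (t * r k)                           ≈⟨ *-congˡ (*-shiftedPower t q k) ⟩
      g k * (r (suc k) + q ^ k * r k)           ≈⟨ distribˡ _ _ _ ⟩
      g k * r (suc k) + g k * (q ^ k * r k)     ≈⟨ +-congˡ (sym (xy∙z≈y∙xz _ _ _)) ⟩
      g k * r (suc k) + h k                     ∎

    h-n≈0 : h n ≈ 0#
    h-n≈0 = trans (*-congʳ (trans (*-congˡ (gauss-> q i<n)) (zeroʳ _))) (zeroˡ _)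

    extend : ∑[ k < n ] h (toℕ k) ≈ h 0 + B
    extend = begin
      ∑[ k < n ] h (toℕ k)         ≈⟨ +-identityʳ _ ⟨
      ∑[ k < n ] h (toℕ k) + 0#    ≈⟨ +-congˡ h-n≈0 ⟨
      ∑[ k < n ] h (toℕ k) + h n   ≈⟨ sum-snoc h n ⟨
      h 0 + B                      ∎

  -- The signed q-power as a shifted power.

  sucC2 : ∀ k → suc k C 2 ≡ k ℕ.+ k C 2
  sucC2 k = ≡.trans (≡.sym (nCk+nC[k+1]≡[n+1]C[k+1] k 1)) (≡.cong (ℕ._+ k C 2) (nC1≡n k))

  module _ (a x q : Carrier) (x#0 : x # 0#) (q#0 : q # 0#) where

    private
      t = a / x [ x#0 ]

      s : ℕ → Carrier
      s k = a / (q ^ k * x) [ x#0y#0→xy#0 (^#0 q#0 k) x#0 ]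

    -1*q^k[1-s]≈t-q^k : ∀ k → - 1# * (q ^ k * (1# - s k)) ≈ t - q ^ k
    -1*q^k[1-s]≈t-q^k k = begin
      - 1# * (q ^ k * (1# - s k))        ≈⟨ -1*x≈-x _ ⟩
      - (q ^ k * (1# - s k))             ≈⟨ -‿cong (x[y-z]≈xy-xz _ 1# _) ⟩
      - (q ^ k * 1# - q ^ k * s k)       ≈⟨ ⁻¹-anti-homo-// _ _ ⟩
      q ^ k * s k - q ^ k * 1#           ≈⟨ +-cong q^k*s≈t (-‿cong (*-identityʳ _)) ⟩
      t - q ^ k                          ∎
      where
      -- The factor `q ^ k` cancels against the one in the denominator of `s k`.
      q^k*s≈t : q ^ k * s k ≈ t
      q^k*s≈t = sym (/-unique x#0 (trans (xy∙z≈y∙xz _ _ _) (/-*-cancel a _)))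

    -- Passing from `k` to `suc k`, the sign contributes `- 1#`, the binomial exponent grows by `k`
    -- (`sucC2`), and the q-power gains `1# - s k`. Together these make up the new factor
    -- `t - q ^ k`.
    qPower≈shiftedPower : ∀ k →
      (- 1#) ^ k * q ^ (k C 2) * qPower x a q x#0 q#0 k ≈ shiftedPower t q k
    qPower≈shiftedPower ℕ.zero  = trans (*-identityʳ _) (*-identityʳ _)
    qPower≈shiftedPower (suc k) = begin
      - 1# * ε * q ^ (suc k C 2) * qPower x a q x#0 q#0 (suc k)
        ≈⟨ *-cong (*-congˡ (trans (reflexive (≡.cong (q ^_) (sucC2 k))) (^-homo-* q k (k C 2))))
                  (product-snoc (λ j → 1# - s j) k) ⟩
      - 1# * ε * (q ^ k * Q) * (P * (1# - s k))
        ≈⟨ *-cong (interchange _ _ _ _) (*-comm _ _) ⟩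
      - 1# * q ^ k * (ε * Q) * ((1# - s k) * P)
        ≈⟨ interchange _ _ _ _ ⟩
      - 1# * q ^ k * (1# - s k) * (ε * Q * P)
        ≈⟨ *-cong (trans (*-assoc _ _ _) (-1*q^k[1-s]≈t-q^k k)) (qPower≈shiftedPower k) ⟩
      shiftedPower t q (suc k) ∎
      where
      ε = (- 1#) ^ k
      Q = q ^ (k C 2)
      P = qPower x a q x#0 q#0 k

-- Assembly by exchanging the two sums.

theorem6 : {ℓ ℓ₁ ℓ₂ : Level} (F : HeytingField ℓ ℓ₁ ℓ₂) →
    let open HeytingField F
        open QCalculus F
    in
    (m : ℕ) (c : Fin (suc m) → Carrier) (a x q : Carrier)
    (a#0 : a # 0#) (x#0 : x # 0#) (q#0 : q # 0#)
    (qq#0 : qPochhammer q m # 0#) →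
    ∑[ i ≤ m ] (c i / x ^ toℕ i [ ^#0 x#0 (toℕ i) ])
    ≈
    ∑[ k ≤ m ]
      ( (∑[ i ≥ k ]
          ( c i / a ^ toℕ i [ ^#0 a#0 (toℕ i) ]
            * qBinomial q (toℕ i) (toℕ k) (qBinomialDenominator#0 {q} qq#0 i k) ))
        * (- 1#) ^ toℕ k * q ^ (toℕ k C 2)
        * qPower x a q x#0 q#0 (toℕ k) )
theorem6 F m c a x q a#0 x#0 q#0 qq#0 = begin
  ∑[ i ≤ m ] (c i / x ^ toℕ i [ ^#0 x#0 (toℕ i) ])
    ≈⟨ sum-cong-≋ {suc m} expand ⟩
  ∑[ i ≤ m ] (∑[ k ≤ m ] (d i * gauss F q (toℕ i) (toℕ k) * r k))
    ≈⟨ ∑-comm {suc m} {suc m} (λ i k → d i * gauss F q (toℕ i) (toℕ k) * r k) ⟩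
  ∑[ k ≤ m ] (∑[ i ≤ m ] (d i * gauss F q (toℕ i) (toℕ k) * r k))
    ≈⟨ sum-cong-≋ {suc m} collect ⟩
  ∑[ k ≤ m ]
    ( (∑[ i ≥ k ] (d i * qBinomial q (toℕ i) (toℕ k) (qBinomialDenominator#0 {q} qq#0 i k)))
      * (- 1#) ^ toℕ k * q ^ (toℕ k C 2)
      * qPower x a q x#0 q#0 (toℕ k) ) ∎
  where
  open HeytingField F hiding (zero)
  open HeytingCommutativeRing heytingCommutativeRing using (commutativeRing)
  open CommutativeRing commutativeRing using (semiring)
  open QCalculus F
  open import Algebra.Properties.Semiring.Sum semiring
    using (sum-cong-≋; ∑-comm; *-distribˡ-sum; *-distribʳ-sum)
  open import Relation.Binary.Reasoning.Setoid setoid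

  d : Fin (suc m) → Carrier
  d i = c i / a ^ toℕ i [ ^#0 a#0 (toℕ i) ]

  r : Fin (suc m) → Carrier
  r k = shiftedPower F (a / x [ x#0 ]) q (toℕ k)

  expand : ∀ i → c i / x ^ toℕ i [ ^#0 x#0 (toℕ i) ] ≈
                 ∑[ k ≤ m ] (d i * gauss F q (toℕ i) (toℕ k) * r k)
  expand i = begin
    c i / x ^ toℕ i [ ^#0 x#0 (toℕ i) ]
      ≈⟨ /-^-rescale F (c i) a#0 x#0 (toℕ i) ⟩
    d i * (a / x [ x#0 ]) ^ toℕ i
      ≈⟨ *-congˡ (cauchyExpansion F _ q (toℕ<n i)) ⟩
    d i * ∑[ k ≤ m ] (gauss F q (toℕ i) (toℕ k) * r k)
      ≈⟨ *-distribˡ-sum {suc m} (d i) (λ k → gauss F q (toℕ i) (toℕ k) * r k) ⟩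
    ∑[ k ≤ m ] (d i * (gauss F q (toℕ i) (toℕ k) * r k))
      ≈⟨ sum-cong-≋ {suc m} (λ k → sym (*-assoc (d i) (gauss F q (toℕ i) (toℕ k)) (r k))) ⟩
    ∑[ k ≤ m ] (d i * gauss F q (toℕ i) (toℕ k) * r k) ∎

  collect : ∀ k →
    ∑[ i ≤ m ] (d i * gauss F q (toℕ i) (toℕ k) * r k) ≈
    (∑[ i ≥ k ] (d i * qBinomial q (toℕ i) (toℕ k) (qBinomialDenominator#0 {q} qq#0 i k)))
      * (- 1#) ^ toℕ k * q ^ (toℕ k C 2)
      * qPower x a q x#0 q#0 (toℕ k)
  collect k = begin
    ∑[ i ≤ m ] (d i * gauss F q (toℕ i) (toℕ k) * r k)
      ≈⟨ *-distribʳ-sum {suc m} (r k) (λ i → d i * gauss F q (toℕ i) (toℕ k)) ⟨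
    (∑[ i ≤ m ] (d i * gauss F q (toℕ i) (toℕ k))) * r k
      -- Until here `gauss` allowed `i` to run over the full range. The terms with `i < k` are zero,
      -- and on the remaining ones `gauss` agrees with `qBinomial`.
      ≈⟨ *-cong (sum≈sumFrom F k
           (λ i i<k → trans (*-congˡ (gauss-> F q i<k)) (zeroʳ _))
           (λ i k≤i → *-congˡ (sym (qBinomial≈gauss F q k≤i _))))
           (sym (qPower≈shiftedPower F a x q x#0 q#0 (toℕ k))) ⟩
    S * ((- 1#) ^ toℕ k * q ^ (toℕ k C 2) * qPower x a q x#0 q#0 (toℕ k))
      ≈⟨ *-assoc _ _ _ ⟨
    S * ((- 1#) ^ toℕ k * q ^ (toℕ k C 2)) * qPower x a q x#0 q#0 (toℕ k)
      ≈⟨ *-congʳ (sym (*-assoc _ _ _)) ⟩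
    S * (- 1#) ^ toℕ k * q ^ (toℕ k C 2) * qPower x a q x#0 q#0 (toℕ k) ∎
    where
    S = ∑[ i ≥ k ] (d i * qBinomial q (toℕ i) (toℕ k) (qBinomialDenominator#0 {q} qq#0 i k))
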